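{- Let $\Sigma$ be a finite non-empty alphabet, $w\in\Sigma^*$ and $k,\ell\in\mathbb N$. If there exist a letter $a$ occurring in $w$, an integer exponent $k'\ge 0$ with $k'\ge k-\ell$, and words $x,y\in\Sigma^*$ with $|w|_a\ge k$ and $w=x\,a^{k'}y$, then the equivalence class of $w$ under $\overset{J}{\sim}_{k,\ell}$ is infinite.
   Context: $\mathbb N=\{1,2,\dots\}$, $\mathbb N_0=\mathbb N\cup\{0\}$. For a word $w\in\Sigma^*$, $|w|$ is its length, $|w|_a$ the number of occurrences of the letter $a$ in $w$, and $p(w)=(|w|_a)_{a\in\Sigma}$ its Parikh vector; $p(u)\le p(w)$ is meant componentwise. $\mathrm{ScatFact}(w)$ is the set of (not necessarily contiguous) subsequences of $w$. For $S\subseteq\Sigma^*$, $S_k=S\cap\Sigma^k$ and $S_{\le k}=\bigcup_{i=0}^k S_i$. For $\ell\in\mathbb N_0$, $\mathrm{JScatFact}(w,\ell)$ is the set of words $u\in\Sigma^*$ with $0\le\ell\le|u|-1$ (with only $\ell=0$ allowed if $u$ is empty), $p(u)\le p(w)$, and such that there is $v\in\mathrm{ScatFact}_{|u|-\ell}(u)$ with $v\in\mathrm{ScatFact}(w)$. For $v,w\in\Sigma^*$, $v\overset{J}{\sim}_{k,\ell}w$ means $\mathrm{JScatFact}_{\le k}(v,\ell)=\mathrm{JScatFact}_{\le k}(w,\ell)$; this is an equivalence relation on $\Sigma^*$. -}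

module Defs where

open import Data.Fin.Base using (Fin)
open import Data.Fin.Properties using (inj⇒≟)
open import Data.List.Base using (List; length; filter)
open import Data.List.Relation.Binary.Sublist.Propositional using (_⊆_)
open import Data.Nat.Base using (ℕ; _≤_; _∸_)
open import Data.Product.Base using (∃; ∃-syntax; _×_)
open import Function.Bundles using (_↔_)
open import Function.Definitions using (Injective)
open import Function.Properties.Inverse using (↔⇒↣)
open import Level using (Level)
open import Relation.Binary.Core using (Rel)
open import Relation.Binary.Definitions using (DecidableEquality)
open import Relation.Binary.PropositionalEquality.Core using (_≡_)
open import Relation.Unary using (Pred; _∈_; _∩_; _≐_)

private
  variable
    a p : Level

-- Positive form of infinitude: an injective sequence of elements of P.
-- Constructively this implies that no finite list contains all elements of P,
-- and classically the two are equivalent.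
Infinite : {X : Set a} → Pred X p → Set _
Infinite {X = X} P =
  ∃ λ (f : ℕ → X) → Injective _≡_ _≡_ f × (∀ i → f i ∈ P)

module Words {A : Set a} {n : ℕ} (finite : A ↔ Fin n) where

  _≟_ : DecidableEquality A
  _≟_ = inj⇒≟ (↔⇒↣ finite)

  Word : Set a
  Word = List A

  ∣_∣₍_₎ : Word → A → ℕ
  ∣ w ∣₍ x ₎ = length (filter (x ≟_) w)

  parikh : Word → A → ℕ
  parikh w x = ∣ w ∣₍ x ₎

  infix 4 _≤ᵖ_
  _≤ᵖ_ : Rel (A → ℕ) a
  f ≤ᵖ g = ∀ x → f x ≤ g x

  OfLength : ℕ → Pred Word _
  OfLength k w = length w ≡ k

  infixl 8 _⟨_⟩ _⟨≤_⟩
  _⟨_⟩ : Pred Word p → ℕ → Pred Word p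
  S ⟨ k ⟩ = S ∩ OfLength k

  _⟨≤_⟩ : Pred Word p → ℕ → Pred Word p
  (S ⟨≤ k ⟩) w = ∃[ i ] i ≤ k × w ∈ S ⟨ i ⟩

  -- The sublist relation deletes letters but keeps the order: subsequences.
  ScatFact : Word → Pred Word a
  ScatFact w v = v ⊆ w

  -- Truncated subtraction in ℓ ≤ length u ∸ 1 allows exactly ℓ = 0 when u is
  -- empty, which is the convention wanted there; for nonempty u it is ordinary
  -- subtraction, and so is length u ∸ ℓ in view of this bound.
  JScatFact : Word → ℕ → Pred Word a
  JScatFact w ℓ u =
      ℓ ≤ length u ∸ 1
    × parikh u ≤ᵖ parikh w
    × ∃[ v ] v ∈ ScatFact u ⟨ length u ∸ ℓ ⟩ × v ∈ ScatFact w

  infix 4 _∼[_,_]_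
  _∼[_,_]_ : Word → ℕ → ℕ → Word → Set a
  v ∼[ k , ℓ ] w = JScatFact v ℓ ⟨≤ k ⟩ ≐ JScatFact w ℓ ⟨≤ k ⟩

  Class : ℕ → ℕ → Word → Pred Word a
  Class k ℓ w v = v ∼[ k , ℓ ] w

{-# OPTIONS --safe #-}
-- Pumping the block a^k' leaves the class unchanged. The letter counts of a
-- word of length at most k cannot detect it, since w already has k letters a;
-- and a scattered factor of length at most k - ℓ ≤ k' uses at most k' letters
-- of the pumped block.
module Submission where

open import Defs
open import Data.Fin.Base using (Fin)
open import Data.List.Base using (List; []; _∷_; _++_; replicate; length; filter)
open import Data.List.Membership.Propositional using (_∈_)
open import Data.List.Properties using (length-replicate; length-filter; filter-++; filter-none; ++-cancelˡ; ++-cancelʳ)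
open import Data.List.Relation.Binary.Sublist.Propositional using (_⊆_; minimum; _∷ʳ_; _∷_; ⊆-refl; ⊆-trans)
open import Data.List.Relation.Binary.Sublist.Propositional.Properties using (++⁺; ++⁺ˡ; filter⁺; length-mono-≤)
open import Data.List.Relation.Unary.All.Properties using (replicate⁺)
open import Data.Nat.Base using (ℕ; zero; suc; NonZero; _≥_; _≤_; _∸_; _+_; z≤n; s≤s)
open import Data.Nat.Properties using (≤-trans; ≤-reflexive; m≤m+n; <⇒≤; ∸-monoˡ-≤; +-cancelˡ-≡)
open import Data.Product.Base using (∃-syntax; _×_; _,_)
open import Function.Bundles using (_↔_)
open import Level using (Level)
open import Relation.Binary.PropositionalEquality using (_≡_; _≢_; refl; sym; trans; cong; module ≡-Reasoning)
open import Relation.Nullary using (yes; no)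

private
  variable
    s : Level
    A : Set s

replicate⁺-⊆ : ∀ {m n} (a : A) → m ≤ n → replicate m a ⊆ replicate n a
replicate⁺-⊆ a z≤n       = minimum _
replicate⁺-⊆ a (s≤s m≤n) = refl ∷ replicate⁺-⊆ a m≤n

pump : List A → A → List A → ℕ → List A
pump x a y m = x ++ replicate m a ++ y

pump-mono-⊆ : ∀ (x : List A) a y {m n} → m ≤ n → pump x a y m ⊆ pump x a y n
pump-mono-⊆ x a y m≤n = ++⁺ (⊆-refl {x = x}) (++⁺ (replicate⁺-⊆ a m≤n) ⊆-refl)

-- Cancelling `x` and `y` leaves two blocks, whose lengths are the exponents. This keeps the words
-- of the family distinct.
pump-injective : ∀ (x : List A) a y {m n} → pump x a y m ≡ pump x a y n → m ≡ n
pump-injective x a y {m} {n} eq =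
  trans (sym (length-replicate m)) (trans (cong length blocks≡) (length-replicate n))
  where
  blocks≡ : replicate m a ≡ replicate n a
  blocks≡ = ++-cancelʳ y _ _ (++-cancelˡ x _ _ eq)

short-⊆-pump : ∀ (x : List A) a y m n {v} → length v ≤ n →
               v ⊆ pump x a y m → v ⊆ pump x a y n
-- The old block is exhausted: the rest of `v` lies in `y`, and the remaining new copies are all
-- skipped.
short-⊆-pump []      a y zero    n       _           v⊆          = ++⁺ˡ (replicate n a) v⊆
short-⊆-pump []      a y (suc m) n       |v|≤n       (_ ∷ʳ v⊆)   = short-⊆-pump [] a y m n |v|≤n v⊆
-- A matched block letter costs one unit of both `length v` and `n`, so the bound survives; it also
-- rules out `n = 0` here.
short-⊆-pump []      a y (suc m) (suc n) (s≤s |v|≤n) (b≡a ∷ v⊆)  = b≡a ∷ short-⊆-pump [] a y m n |v|≤n v⊆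
short-⊆-pump (b ∷ x) a y m       n       |v|≤n       (_ ∷ʳ v⊆)   = b ∷ʳ short-⊆-pump x a y m n |v|≤n v⊆
short-⊆-pump (b ∷ x) a y m       n       |v|<n       (c≡b ∷ v⊆)  = c≡b ∷ short-⊆-pump x a y m n (<⇒≤ |v|<n) v⊆

module _ {A : Set s} {n : ℕ} (finite : A ↔ Fin n) where
  open Words finite

  parikh-mono-⊆ : ∀ {u w} → u ⊆ w → parikh u ≤ᵖ parikh w
  parikh-mono-⊆ u⊆w b = length-mono-≤ (filter⁺ (b ≟_) (b ≟_) (λ { refl eq → eq }) u⊆w)

  -- The right side is free of `m`, so the counts of `b` for any two exponents can be compared
  -- through it.
  parikh-pump-≢ : ∀ x a y m {b} → b ≢ a → parikh (pump x a y m) b ≡ parikh (x ++ y) b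
  parikh-pump-≢ x a y m {b} b≢a = cong length (begin
    filter (b ≟_) (x ++ replicate m a ++ y)
      ≡⟨ filter-++ (b ≟_) x _ ⟩
    filter (b ≟_) x ++ filter (b ≟_) (replicate m a ++ y)
      ≡⟨ cong (filter (b ≟_) x ++_) (filter-++ (b ≟_) (replicate m a) y) ⟩
    filter (b ≟_) x ++ filter (b ≟_) (replicate m a) ++ filter (b ≟_) y
      ≡⟨ cong (λ z → filter (b ≟_) x ++ z ++ filter (b ≟_) y)
              (filter-none (b ≟_) (replicate⁺ m b≢a)) ⟩
    filter (b ≟_) x ++ filter (b ≟_) y
      ≡⟨ filter-++ (b ≟_) x y ⟨
    filter (b ≟_) (x ++ y) ∎)
    where open ≡-Reasoning

  JScatFact-mono-⊆ : ∀ {w w′} ℓ {u} → w ⊆ w′ → JScatFact w ℓ u → JScatFact w′ ℓ u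
  JScatFact-mono-⊆ ℓ w⊆w′ (ℓ≤ , pu≤pw , v , v∈ , v⊆w) =
    ℓ≤ , (λ b → ≤-trans (pu≤pw b) (parikh-mono-⊆ w⊆w′ b)) , v , v∈ , ⊆-trans v⊆w w⊆w′

  JScatFact-pump : ∀ x a y m k′ {k} ℓ {u} → k ∸ ℓ ≤ k′ → k ≤ ∣ pump x a y k′ ∣₍ a ₎ →
                   length u ≤ k → JScatFact (pump x a y m) ℓ u → JScatFact (pump x a y k′) ℓ u
  JScatFact-pump x a y m k′ ℓ {u} k∸ℓ≤k′ k≤|w|ₐ |u|≤k (ℓ≤ , pu≤ , v , (v⊆u , |v|≡) , v⊆) =
    ℓ≤ , pu≤′ , v , (v⊆u , |v|≡) , short-⊆-pump x a y m k′ |v|≤k′ v⊆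
    where
    |v|≤k′ : length v ≤ k′
    -- The chain is `length v = length u ∸ ℓ ≤ k ∸ ℓ ≤ k′`.
    |v|≤k′ = ≤-trans (≤-reflexive |v|≡) (≤-trans (∸-monoˡ-≤ ℓ |u|≤k) k∸ℓ≤k′)

    pu≤′ : parikh u ≤ᵖ parikh (pump x a y k′)
    pu≤′ b with b ≟ a
    -- The count of `a` may drop on passing to exponent `k′`, so it is bounded through
    -- `length u ≤ k` instead of through `pu≤`.
    ... | yes refl = ≤-trans (length-filter (b ≟_) u) (≤-trans |u|≤k k≤|w|ₐ)
    ... | no  b≢a  = ≤-trans (pu≤ b) (≤-reflexive
                       (trans (parikh-pump-≢ x a y m b≢a) (sym (parikh-pump-≢ x a y k′ b≢a))))

proposition27 : ∀ {s} {A : Set s} {n : ℕ} .{{_ : NonZero n}} (finite : A ↔ Fin n) →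
    let open Words finite in
    (w : Word) (k ℓ : ℕ) → k ≥ 1 → ℓ ≥ 1 →
    (∃[ a ] ∃[ k' ] ∃[ x ] ∃[ y ]
    (a ∈ w × k' ≥ k ∸ ℓ × ∣ w ∣₍ a ₎ ≥ k × w ≡ x ++ replicate k' a ++ y)) →
    Infinite (Class k ℓ w)
proposition27 finite w k ℓ _ _ (a , k′ , x , y , _ , k∸ℓ≤k′ , k≤|w|ₐ , refl) =
    -- Starting at exponent `k′` makes `w` a subsequence of every member, so one of the two
    -- inclusions is plain monotonicity.
    (λ i → pump x a y (k′ + i))
  , (λ eq → +-cancelˡ-≡ k′ _ _ (pump-injective x a y eq))
  , λ i →
      -- Matching `refl` turns `j` into `length u`, so `j≤k` becomes the length bound on `u`.
      (λ { (j , j≤k , u∈ , refl) →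
           j , j≤k , JScatFact-pump finite x a y (k′ + i) k′ ℓ k∸ℓ≤k′ k≤|w|ₐ j≤k u∈ , refl })
    , (λ { (j , j≤k , u∈ , |u|≡j) →
           j , j≤k , JScatFact-mono-⊆ finite ℓ (pump-mono-⊆ x a y (m≤m+n k′ i)) u∈ , |u|≡j })
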